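{- Let $M$ be a matroid with an adjoint map $\phi$ to $M'$. If $D$ is a coindependent set in $M$, then there is an adjoint map $\phi_{\backslash D}$ from $M\backslash D$ to $N=M'\backslash\phi(\mathcal{H}(M,D))$ given by $\phi_{\backslash D}(F)=\phi(\mathrm{cl}_M(F))-\phi(\mathcal{H}(M,D))$ for flats $F$ of $M\backslash D$.
   Context: Matroid terminology follows Oxley's book; in particular matroids are finite. $E(M)$ is the ground set of $M$, $r_M$ its rank function, $\mathrm{cl}_M$ its closure operator, $\mathcal{F}(M)$ the collection of flats of $M$, and $M\backslash D$ is deletion. A set $D\subseteq E(M)$ is coindependent in $M$ if it is independent in the dual matroid $M^*$ (equivalently, $r_M(E(M)-D)=r(M)$). A hyperplane of $M$ is a flat of rank $r(M)-1$; a point is a flat of rank $1$ (in a simple matroid, the points are exactly the singletons of elements of the ground set, and are identified with the elements). Definition. Let $M$ be a matroid, and let $M'$ be a simple matroid with the same rank as $M$. Then $M'$ is an adjoint of $M$ if there is a map $\phi:\mathcal{F}(M)\rightarrow\mathcal{F}(M')$ such that (i) $\phi$ is injective; (ii) if $F_1,F_2\in\mathcal{F}(M)$ and $F_1\subseteq F_2$, then $\phi(F_2)\subseteq\phi(F_1)$; and (iii) $\phi$ restricts to a bijection from the set of hyperplanes of $M$ onto the set of points of $M'$. Such a map $\phi$ is called an adjoint map from $M$ to $M'$. (Thus saying that there is an adjoint map from one matroid to another includes that the second matroid is simple and has the same rank as the first.) Definition. For a matroid $M$ and $D\subseteq E(M)$, let $\mathcal{H}(M)$ be the set of hyperplanes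 of $M$ and let $\mathcal{H}(M,D)=\{H\in\mathcal{H}(M): r_M(H-D)<r_M(H)\}$. Since $\phi$ maps each hyperplane of $M$ to a point of $M'$, i.e. to (the singleton of) an element of $E(M')$, the notation $\phi(\mathcal{H}(M,D))$ means the set of elements of $E(M')$ that are images under $\phi$ of the members of $\mathcal{H}(M,D)$; it is a subset of $E(M')$. -}

module Defs where

open import Axiom.UniquenessOfIdentityProofs using (module Decidable⇒UIP)
import Data.Bool.Properties as Bool
open import Data.Fin.Base using (Fin)
open import Data.Fin.Subset
open import Data.Fin.Subset.Properties
open import Data.List.Base as List using (List; []; _∷_; filter)
open import Data.List.Extrema.Nat using (argmax; argmax-all; f[xs]≤f[argmax])
open import Data.List.Membership.Propositional as List∈ using ()
open import Data.List.Membership.Propositional.Properties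
  using (∈-map⁺; ∈-++⁺ˡ; ∈-++⁺ʳ; ∈-filter⁺)
open import Data.List.Relation.Unary.All as All using ()
open import Data.List.Relation.Unary.All.Properties using (all-filter)
open import Data.List.Relation.Unary.Any using (here)
open import Data.Nat.Base using (ℕ; zero; suc; _≤_; _<_)
open import Data.Nat.Properties
  using (≤-antisym; ≤-trans; ≤-reflexive; ≮⇒≥; <⇒≱; _<?_) renaming (_≟_ to _≟ℕ_)
open import Data.Product.Base using (Σ-syntax; ∃; ∃-syntax; _×_; _,_; proj₁; proj₂)
open import Data.Sum.Base using (inj₁; inj₂; [_,_]′)
open import Data.Vec.Base using (tabulate; []; _∷_)
open import Data.Vec.Properties using (≡-dec; lookup⇒[]=; []=⇒lookup; lookup∘tabulate)
open import Function.Base using (_∘_; id)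
open import Function.Definitions using (Injective; Bijective)
open import Relation.Binary.Definitions using (DecidableEquality)
open import Relation.Binary.PropositionalEquality
  using (_≡_; _≢_; refl; sym; trans; cong; subst)
open import Relation.Nullary using (¬_; Dec; yes; no; does; contradiction)
open import Relation.Nullary.Decidable using (_×-dec_; map′; dec-true)
open import Relation.Unary using (Pred; Decidable)

private
  variable
    m n : ℕ

_≟ˢ_ : DecidableEquality (Subset n)
_≟ˢ_ = ≡-dec Bool._≟_

comprehension : ∀ {P : Fin n → Set} → Decidable P → Subset n
comprehension P? = tabulate (does ∘ P?)

∈-comprehension⁺ : ∀ {P : Fin n → Set} (P? : Decidable P) {x} →
                   P x → x ∈ comprehension P?
∈-comprehension⁺ P? {x} px =
  lookup⇒[]= x _ (trans (lookup∘tabulate _ x) (dec-true (P? x) px))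

∈-comprehension⁻ : ∀ {P : Fin n → Set} (P? : Decidable P) {x} →
                   x ∈ comprehension P? → P x
∈-comprehension⁻ P? {x} x∈
  with P? x | trans (sym (lookup∘tabulate (does ∘ P?) x)) ([]=⇒lookup x∈)
... | yes px | _ = px
... | no  _  | ()

subsets : ∀ n → List (Subset n)
subsets zero    = [] ∷ []
subsets (suc n) = List.map (inside ∷_) (subsets n) List.++ List.map (outside ∷_) (subsets n)

∈-subsets : (X : Subset n) → X List∈.∈ subsets n
∈-subsets []            = here refl
∈-subsets (inside ∷ X)  = ∈-++⁺ˡ (∈-map⁺ _ (∈-subsets X))
∈-subsets (outside ∷ X) = ∈-++⁺ʳ _ (∈-map⁺ _ (∈-subsets X))

-- The ground set E is an arbitrary subset of an ambient finite set Fin n, so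
-- that a deletion lives in the same ambient set. Elements of Fin n outside E
-- play no role. Independence is decidable because matroids are finite.
record Matroid (n : ℕ) : Set₁ where
  field
    E       : Subset n
    Indep   : Subset n → Set
    indep?  : Decidable Indep
    indep⊆E : ∀ {I} → Indep I → I ⊆ E
    empty   : Indep ⊥
    down    : ∀ {I J} → I ⊆ J → Indep J → Indep I
    augment : ∀ {I J} → Indep I → Indep J → ∣ I ∣ < ∣ J ∣ →
              ∃[ e ] e ∈ J × e ∉ I × Indep (I ∪ ⁅ e ⁆)

infixl 5 _∖_

_∖_ : Matroid n → Subset n → Matroid n
M ∖ D = record
  { E       = E ─ D
  ; Indep   = λ I → Indep I × I ⊆ E ─ D
  ; indep?  = λ I → indep? I ×-dec (I ⊆? (E ─ D))
  ; indep⊆E = proj₂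
  ; empty   = empty , ⊥⊆
  ; down    = λ I⊆J (iJ , J⊆) → down I⊆J iJ , λ x∈I → J⊆ (I⊆J x∈I)
  ; augment = λ {I} {J} (iI , I⊆) (iJ , J⊆) lt →
      let (e , e∈J , e∉I , i) = augment iI iJ lt in
      e , e∈J , e∉I , i ,
      λ x∈ → [ I⊆
             , (λ x∈e → subst (_∈ (E ─ D)) (sym (x∈⁅y⁆⇒x≡y e x∈e)) (J⊆ e∈J)) ]′
             (x∈p∪q⁻ I ⁅ e ⁆ x∈)
  }
  where open Matroid M

module _ (M : Matroid n) where
  open Matroid M

  IsBasis : Subset n → Set
  IsBasis B = Indep B × (∀ {I} → Indep I → B ⊆ I → I ≡ B)

  -- The bases of the dual matroid are the complements E ─ B of the bases B, and
  -- its independent sets are the subsets of these.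
  Coindependent : Subset n → Set
  Coindependent D = ∃[ B ] IsBasis B × D ⊆ E ─ B

  IsCircuit : Subset n → Set
  IsCircuit C = C ⊆ E × ¬ Indep C × (∀ {I} → I ⊂ C → Indep I)

  IsLoop : Fin n → Set
  IsLoop e = IsCircuit ⁅ e ⁆

  Parallel : Fin n → Fin n → Set
  Parallel e f = e ≢ f × IsCircuit (⁅ e ⁆ ∪ ⁅ f ⁆)

  IsSimple : Set
  IsSimple = (∀ e → ¬ IsLoop e) × (∀ e f → ¬ Parallel e f)

  independentSubsets : Subset n → List (Subset n)
  independentSubsets X = filter (λ I → indep? I ×-dec (I ⊆? X)) (subsets n)

  maxIndep : Subset n → Subset n
  maxIndep X = argmax ∣_∣ ⊥ (independentSubsets X)

  r : Subset n → ℕ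
  r X = ∣ maxIndep X ∣

  rank : ℕ
  rank = r E

  inClosure? : ∀ X e → Dec (e ∈ E × r (X ∪ ⁅ e ⁆) ≡ r X)
  inClosure? X e = (e ∈? E) ×-dec (r (X ∪ ⁅ e ⁆) ≟ℕ r X)

  cl : Subset n → Subset n
  cl X = comprehension (inClosure? X)

  record Flat : Set where
    constructor flat
    field
      set    : Subset n
      closed : cl set ≡ set

open Flat public

module _ {M : Matroid n} where

  flat-≡ : {F G : Flat M} → set F ≡ set G → F ≡ G
  flat-≡ {flat X p} {flat .X q} refl =
    cong (flat X) (Decidable⇒UIP.≡-irrelevant _≟ˢ_ p q)

  anyFlat? : {P : Flat M → Set} → Decidable P → Dec (∃ P)
  anyFlat? {P} P? =
    map′ (λ (X , c , p) → flat X c , p) (λ (flat X c , p) → X , c , p)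
         (anySubset? dec)
    where
    dec : Decidable (λ X → Σ[ c ∈ cl M X ≡ X ] P (flat X c))
    dec X with cl M X ≟ˢ X
    ... | no ¬c = no (¬c ∘ proj₁)
    ... | yes c = map′ (c ,_) (λ (_ , p) → subst P (flat-≡ refl) p) (P? (flat X c))

  -- In rank 0 there are no hyperplanes.
  IsHyperplane : Flat M → Set
  IsHyperplane H = suc (r M (set H)) ≡ rank M

  IsPoint : Flat M → Set
  IsPoint P = r M (set P) ≡ 1

record IsAdjointMap (M : Matroid m) (M′ : Matroid n) (φ : Flat M → Flat M′) : Set where
  field
    simple    : IsSimple M′
    same-rank : rank M′ ≡ rank M
    injective : Injective _≡_ _≡_ φ
    antitone  : ∀ {F₁ F₂} → set F₁ ⊆ set F₂ → set (φ F₂) ⊆ set (φ F₁)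
    toPoint   : ∀ {H} → IsHyperplane H → IsPoint (φ H)

  restriction : ∃ (IsHyperplane {M = M}) → ∃ (IsPoint {M = M′})
  restriction (H , h) = φ H , toPoint h

  field
    bijective : Bijective _≡_ _≡_ restriction

𝓗 : (M : Matroid n) → Subset n → Pred (Flat M) _
𝓗 M D H = IsHyperplane H × r M (set H ─ D) < r M (set H)

𝓗? : (M : Matroid n) (D : Subset n) → Decidable (𝓗 M D)
𝓗? M D H = (suc (r M (set H)) ≟ℕ rank M) ×-dec (r M (set H ─ D) <? r M (set H))

-- The elements e such that ⁅ e ⁆ is the image under φ of a flat satisfying P:
-- points of a simple matroid are identified with elements of its ground set.
elementImage : {M : Matroid m} {M′ : Matroid n} (φ : Flat M → Flat M′)
               {P : Flat M → Set} → Decidable P → Subset n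
elementImage φ P? =
  comprehension (λ e → anyFlat? (λ H → P? H ×-dec (set (φ H) ≟ˢ ⁅ e ⁆)))

module _ (M : Matroid n) where
  open Matroid M

  maxIndep-spec : ∀ X → Indep (maxIndep M X) × maxIndep M X ⊆ X
  maxIndep-spec X =
    argmax-all ∣_∣ {P = λ I → Indep I × I ⊆ X} (empty , ⊥⊆)
      (all-filter (λ I → indep? I ×-dec (I ⊆? X)) (subsets n))

  indep⇒≤r : ∀ {I X} → Indep I → I ⊆ X → ∣ I ∣ ≤ r M X
  indep⇒≤r {I} {X} i I⊆X =
    All.lookup (f[xs]≤f[argmax] {f = ∣_∣} ⊥ (independentSubsets M X))
      (∈-filter⁺ (λ I → indep? I ×-dec (I ⊆? X)) (∈-subsets I) (i , λ {x} → I⊆X {x}))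

  r-mono : ∀ {X Y} → (∀ {x} → x ∈ X → x ∈ E → x ∈ Y) → r M X ≤ r M Y
  r-mono {X} X⊆Y =
    let (i , I⊆X) = maxIndep-spec X in
    indep⇒≤r i (λ x∈I → X⊆Y (I⊆X x∈I) (indep⊆E i x∈I))

  ⊆-cl : ∀ {X x} → x ∈ X → x ∈ E → x ∈ cl M X
  ⊆-cl {X} {x} x∈X x∈E = ∈-comprehension⁺ (inClosure? M X)
    (x∈E , ≤-antisym (r-mono (λ y∈ _ → [ id , (λ y∈x → subst (_∈ X) (sym (x∈⁅y⁆⇒x≡y x y∈x)) x∈X) ]′
                                         (x∈p∪q⁻ X ⁅ x ⁆ y∈)))
                     (r-mono (λ y∈ _ → p⊆p∪q ⁅ x ⁆ y∈)))

  r-cl : ∀ X → r M (cl M X) ≡ r M X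
  r-cl X = ≤-antisym (≮⇒≥ lt⇒⊥) (r-mono ⊆-cl)
    where
    lt⇒⊥ : ¬ (r M X < r M (cl M X))
    lt⇒⊥ lt =
      let (iB , B⊆X)  = maxIndep-spec X
          (iI , I⊆cl) = maxIndep-spec (cl M X)
          (e , e∈I , e∉B , iB∪e) = augment iB iI lt
          B = maxIndep M X
          req = proj₂ (∈-comprehension⁻ (inClosure? M X) (I⊆cl e∈I))
          B∪e⊆X∪e = λ {x} x∈ → x∈p∪q⁺ {x = x} {p = X} {q = ⁅ e ⁆}
                      ([ (λ x∈B → inj₁ (B⊆X x∈B)) , inj₂ ]′ (x∈p∪q⁻ B ⁅ e ⁆ x∈))
      in contradiction (≤-trans (indep⇒≤r iB∪e B∪e⊆X∪e) (≤-reflexive req))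
                       (<⇒≱ (p⊂q⇒∣p∣<∣q∣
                         (p⊆p∪q {p = B} ⁅ e ⁆ , e , q⊆p∪q B ⁅ e ⁆ (x∈⁅x⁆ e) , e∉B)))

  cl-idem : ∀ X → cl M (cl M X) ≡ cl M X
  cl-idem X = ⊆-antisym to from
    where
    cX = cl M X
    to : cl M cX ⊆ cX
    to {e} e∈ =
      let (e∈E , req) = ∈-comprehension⁻ (inClosure? M cX) e∈ in
      ∈-comprehension⁺ (inClosure? M X)
        ( e∈E
        , ≤-antisym
            (≤-trans (r-mono (λ y∈ y∈E → x∈p∪q⁺ {p = cX} {q = ⁅ e ⁆}
                       ([ (λ y∈X → inj₁ (⊆-cl y∈X y∈E)) , inj₂ ]′ (x∈p∪q⁻ X ⁅ e ⁆ y∈))))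
                     (≤-reflexive (trans req (r-cl X))))
            (r-mono (λ y∈ _ → p⊆p∪q ⁅ e ⁆ y∈)))
    from : cX ⊆ cl M cX
    from x∈ = ⊆-cl x∈ (proj₁ (∈-comprehension⁻ (inClosure? M X) x∈))

  clFlat : Subset n → Flat M
  clFlat X = flat (cl M X) (cl-idem X)

{-# OPTIONS --safe #-}

-- An adjoint map satisfies r(F) + r(φ F) = r(M), because φ carries a chain of
-- flats to a strictly decreasing chain and both matroids have the same rank.
-- Moreover φ reflects inclusion. It is enough that φ G ⊆ φ (cl {p}) forces
-- p ∈ G; if p ∉ G, choose a flat G′ covered by G. The two flats φ G and
-- φ (cl (G′ ∪ {p})) are distinct, of the same rank, and covered by φ G′, so
-- φ G′ ⊆ φ (cl {p}) as well, and descending to rank 0 contradicts the rank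
-- formula.
--
-- If F is a hyperplane of M ∖ D, then cl F is a hyperplane of M outside
-- 𝓗(M, D), so the element φ (cl F) survives in N. Hyperplanes of M ∖ D separate
-- its flats, hence φ∖D reflects inclusion too. Thus φ∖D is injective, and a
-- maximal chain of flats of M ∖ D shows that the rank of N has not dropped.
module Submission where

open import Defs
open import Data.Fin.Base using (Fin; zero; suc)
open import Data.Fin.Properties using (_≟_)
open import Data.Fin.Subset
  using (Subset; inside; outside; ⊥; _∈_; _∉_; _⊆_; _⊂_; _∪_; _─_; _-_; ⁅_⁆; ∣_∣)
open import Data.Fin.Subset.Properties
open import Data.Nat.Base using (ℕ; zero; suc; _+_; _≤_; _<_; z≤n; s≤s)
open import Data.Nat.Properties
  using (≤-trans; ≤-antisym; ≤-reflexive; ≤-pred; n≤1+n; +-suc;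
         +-monoʳ-≤; +-cancelʳ-≤; +-cancelˡ-≡; m≤m+n; <⇒≱; <⇒≢; ≰⇒>; ≮⇒≥;
         ≡-irrelevant; _≤?_; module ≤-Reasoning)
open import Data.Product.Base using (Σ-syntax; ∃; ∃-syntax; _×_; _,_; proj₁; proj₂)
open import Data.Sum.Base using (inj₁; inj₂; [_,_]′)
open import Data.Vec.Base using (_∷_; here; there)
open import Function.Base using (_∘_; id)
open import Function.Definitions using (Injective)
open import Relation.Binary.PropositionalEquality
  using (_≡_; _≢_; refl; sym; trans; cong; subst; module ≡-Reasoning)
open import Relation.Nullary using (¬_; Dec; yes; no; contradiction)
open import Relation.Nullary.Decidable using (_×-dec_; decidable-stable)

private
  variable
    m n : ℕ
    X Y : Subset n
    e : Fin n

-- Finite subsets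

x∈p─q⇒x∉q : (p q : Subset n) → e ∈ p ─ q → e ∉ q
x∈p─q⇒x∉q (_ ∷ p) (_ ∷ q) (there e∈) (there e∈q) = x∈p─q⇒x∉q p q e∈ e∈q
x∈p─q⇒x∉q (_ ∷ p) (_ ∷ q) () here

─-monoˡ-⊆ : (Z : Subset n) → X ⊆ Y → X ─ Z ⊆ Y ─ Z
─-monoˡ-⊆ {X = X} Z X⊆Y x∈ =
  x∈p∧x∉q⇒x∈p─q (X⊆Y (p─q⊆p X Z x∈)) (x∈p─q⇒x∉q X Z x∈)

x∈p⇒⁅x⁆⊆p : e ∈ X → ⁅ e ⁆ ⊆ X
x∈p⇒⁅x⁆⊆p {e = e} {X = X} e∈X x∈ = subst (_∈ X) (sym (x∈⁅y⁆⇒x≡y e x∈)) e∈X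

x∉p⇒⁅x⁆─p≡⁅x⁆ : e ∉ X → ⁅ e ⁆ ─ X ≡ ⁅ e ⁆
x∉p⇒⁅x⁆─p≡⁅x⁆ {e = e} {X = X} e∉X = ⊆-antisym (p─q⊆p ⁅ e ⁆ X)
  (x∈p⇒⁅x⁆⊆p (x∈p∧x∉q⇒x∈p─q (x∈⁅x⁆ e) e∉X))

∪-least : {X Y Z : Subset n} → X ⊆ Z → Y ⊆ Z → X ∪ Y ⊆ Z
∪-least {X = X} {Y} X⊆Z Y⊆Z x∈ with x∈p∪q⁻ X Y x∈
... | inj₁ x∈X = X⊆Z x∈X
... | inj₂ x∈Y = Y⊆Z x∈Y

∪⁅⁆-⊆ : X ⊆ Y → e ∈ Y → X ∪ ⁅ e ⁆ ⊆ Y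
∪⁅⁆-⊆ X⊆Y e∈Y = ∪-least X⊆Y (x∈p⇒⁅x⁆⊆p e∈Y)

∪⁅⁆-mono : (e : Fin n) → X ⊆ Y → X ∪ ⁅ e ⁆ ⊆ Y ∪ ⁅ e ⁆
∪⁅⁆-mono {Y = Y} e X⊆Y =
  ∪-least (λ x∈ → p⊆p∪q ⁅ e ⁆ (X⊆Y x∈)) (q⊆p∪q Y ⁅ e ⁆)

e∈X∪⁅e⁆ : (X : Subset n) (e : Fin n) → e ∈ X ∪ ⁅ e ⁆
e∈X∪⁅e⁆ X e = q⊆p∪q X ⁅ e ⁆ (x∈⁅x⁆ e)

∣p∣<∣p∪⁅x⁆∣ : e ∉ X → ∣ X ∣ < ∣ X ∪ ⁅ e ⁆ ∣
∣p∣<∣p∪⁅x⁆∣ {e = e} {X = X} e∉X =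
  p⊂q⇒∣p∣<∣q∣ (p⊆p∪q {p = X} ⁅ e ⁆ , e , e∈X∪⁅e⁆ X e , e∉X)

∣p∣≤1+∣p-x∣ : (p : Subset n) (x : Fin n) → ∣ p ∣ ≤ suc ∣ p - x ∣
∣p∣≤1+∣p-x∣ (inside  ∷ p) zero    = s≤s (≤-reflexive (cong ∣_∣ (sym (p─⊥≡p p))))
∣p∣≤1+∣p-x∣ (outside ∷ p) zero    = ≤-trans (≤-reflexive (cong ∣_∣ (sym (p─⊥≡p p)))) (n≤1+n _)
∣p∣≤1+∣p-x∣ (inside  ∷ p) (suc x) = s≤s (∣p∣≤1+∣p-x∣ p x)
∣p∣≤1+∣p-x∣ (outside ∷ p) (suc x) = ∣p∣≤1+∣p-x∣ p x

-- Rank, closure and flats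

module _ (M : Matroid n) where
  open Matroid M

  r-mono-⊆ : X ⊆ Y → r M X ≤ r M Y
  r-mono-⊆ X⊆Y = r-mono M (λ x∈ _ → X⊆Y x∈)

  r≤∣_∣ : ∀ X → r M X ≤ ∣ X ∣
  r≤∣ X ∣ = p⊆q⇒∣p∣≤∣q∣ (proj₂ (maxIndep-spec M X))

  r-indep : Indep X → r M X ≡ ∣ X ∣
  r-indep {X} i = ≤-antisym r≤∣ X ∣ (indep⇒≤r M i ⊆-refl)

  r⊥≡0 : r M ⊥ ≡ 0
  r⊥≡0 = trans (r-indep empty) (∣⊥∣≡0 n)

  -- Deleting `e` from a maximum independent subset of `X ∪ ⁅ e ⁆` leaves an independent subset of
  -- `X`.
  r-∪⁅⁆-≤ : ∀ X e → r M (X ∪ ⁅ e ⁆) ≤ suc (r M X)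
  r-∪⁅⁆-≤ X e = ≤-trans (∣p∣≤1+∣p-x∣ J e) (s≤s (indep⇒≤r M (down (p─q⊆p J ⁅ e ⁆) iJ) J-e⊆X))
    where
    J = maxIndep M (X ∪ ⁅ e ⁆)
    iJ = proj₁ (maxIndep-spec M (X ∪ ⁅ e ⁆))
    J-e⊆X : J - e ⊆ X
    J-e⊆X x∈ with x∈p∪q⁻ X ⁅ e ⁆ (proj₂ (maxIndep-spec M (X ∪ ⁅ e ⁆)) (p─q⊆p J ⁅ e ⁆ x∈))
    ... | inj₁ x∈X = x∈X
    ... | inj₂ x∈e = contradiction x∈e (x∈p─q⇒x∉q J ⁅ e ⁆ x∈)

  r-augment : r M X < r M Y → ∃[ e ] e ∈ Y × e ∈ E × r M X < r M (X ∪ ⁅ e ⁆)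
  r-augment {X} {Y} lt =
    let (iI , I⊆X) = maxIndep-spec M X
        (iJ , J⊆Y) = maxIndep-spec M Y
        (e , e∈J , e∉I , i) = augment iI iJ lt
    in e , J⊆Y e∈J , indep⊆E iJ e∈J ,
       ≤-trans (∣p∣<∣p∪⁅x⁆∣ e∉I) (indep⇒≤r M i (∪⁅⁆-mono e I⊆X))

  subset-of-rank : ∀ {k} → r M X ≡ suc k → ∃[ Y ] Y ⊆ X × r M Y ≡ k
  subset-of-rank {X} {k} rX≡ =
    -- Augmenting `⊥` towards `I` picks some element of the nonempty set `I`.
    let (e , e∈I , _) = r-augment {⊥} {I}
          (≤-trans (s≤s (≤-reflexive r⊥≡0)) (≤-trans (s≤s z≤n) (≤-reflexive (sym rI≡))))
    in I - e , (λ x∈ → I⊆X (p─q⊆p I ⁅ e ⁆ x∈)) ,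
       trans (r-indep (down (p─q⊆p I ⁅ e ⁆) iI))
         (≤-antisym (≤-pred (≤-trans (x∈p⇒∣p-x∣<∣p∣ e∈I) (≤-reflexive rX≡)))
                    (≤-pred (≤-trans (≤-reflexive (sym rX≡)) (∣p∣≤1+∣p-x∣ I e))))
    where
    I = maxIndep M X
    iI = proj₁ (maxIndep-spec M X)
    I⊆X = proj₂ (maxIndep-spec M X)
    rI≡ : r M I ≡ suc k
    rI≡ = trans (r-indep iI) rX≡

  -- Augment repeatedly from `maxIndep M X`; `k` bounds the number of elements still missing.
  extend-indep : ∀ {I} → Indep I → I ⊆ X → ∃[ J ] Indep J × I ⊆ J × J ⊆ X × r M X ≤ ∣ J ∣
  extend-indep {X} iI I⊆X = go (r M X) iI I⊆X (m≤m+n _ _)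
    where
    go : ∀ k {I} → Indep I → I ⊆ X → r M X ≤ k + ∣ I ∣ →
         ∃[ J ] Indep J × I ⊆ J × J ⊆ X × r M X ≤ ∣ J ∣
    go zero    {I} iI I⊆X le = I , iI , ⊆-refl , I⊆X , le
    go (suc k) {I} iI I⊆X le with r M X ≤? ∣ I ∣
    ... | yes le′ = I , iI , ⊆-refl , I⊆X , le′
    ... | no ¬le =
      let (iK , K⊆X) = maxIndep-spec M X
          (e , e∈K , e∉I , i) = augment iI iK (≰⇒> ¬le)
          (J , iJ , I∪e⊆J , J⊆X , le′) = go k i (∪⁅⁆-⊆ I⊆X (K⊆X e∈K))
            (≤-trans le (≤-trans (≤-reflexive (sym (+-suc k _))) (+-monoʳ-≤ k (∣p∣<∣p∪⁅x⁆∣ e∉I))))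
      in J , iJ , (λ x∈ → I∪e⊆J (p⊆p∪q ⁅ e ⁆ x∈)) , J⊆X , le′

  cl⊆E : ∀ X → cl M X ⊆ E
  cl⊆E X x∈ = proj₁ (∈-comprehension⁻ (inClosure? M X) x∈)

  ∈-cl⁺ : e ∈ E → r M (X ∪ ⁅ e ⁆) ≤ r M X → e ∈ cl M X
  ∈-cl⁺ {e} {X} e∈E le =
    ∈-comprehension⁺ (inClosure? M X) (e∈E , ≤-antisym le (r-mono-⊆ (p⊆p∪q ⁅ e ⁆)))

  -- Extend a maximum independent subset `I` of `X` to one, `J`, of `Y`. If `x` raised the rank of
  -- `Y`, some `y` would augment `J`: `y ∈ Y` contradicts the size of `J`, and `y ≡ x` makes
  -- `I ∪ ⁅ x ⁆` independent, against `x ∈ cl M X`.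
  cl-mono : X ⊆ Y → cl M X ⊆ cl M Y
  cl-mono {X} {Y} X⊆Y {x} x∈ = ∈-cl⁺ x∈E (≮⇒≥ impossible)
    where
    x∈E = cl⊆E X x∈
    r≡ = proj₂ (∈-comprehension⁻ (inClosure? M X) x∈)
    iI = proj₁ (maxIndep-spec M X)
    I⊆X = proj₂ (maxIndep-spec M X)
    impossible : ¬ (r M Y < r M (Y ∪ ⁅ x ⁆))
    impossible lt =
      let (J , iJ , I⊆J , J⊆Y , rY≤) = extend-indep iI (λ z∈ → X⊆Y (I⊆X z∈))
          (iK , K⊆) = maxIndep-spec M (Y ∪ ⁅ x ⁆)
          (y , y∈K , y∉J , i) = augment iJ iK (≤-trans (s≤s (indep⇒≤r M iJ J⊆Y)) lt)
          y∉Y = λ y∈Y → <⇒≱ (∣p∣<∣p∪⁅x⁆∣ y∉J) (≤-trans (indep⇒≤r M i (∪⁅⁆-⊆ J⊆Y y∈Y)) rY≤)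
          y∉x = λ y∈x → <⇒≱ (∣p∣<∣p∪⁅x⁆∣ (y∉J ∘ I⊆J))
            (≤-trans (indep⇒≤r M (down (∪⁅⁆-mono y I⊆J) i)
                       (subst (λ z → _ ∪ ⁅ z ⁆ ⊆ X ∪ ⁅ x ⁆) (sym (x∈⁅y⁆⇒x≡y x y∈x)) (∪⁅⁆-mono x I⊆X)))
                     (≤-reflexive r≡))
      in [ y∉Y , y∉x ]′ (x∈p∪q⁻ Y ⁅ x ⁆ (K⊆ y∈K))

  IsSimple⇒indep-⁅⁆ : IsSimple M → e ∈ E → Indep ⁅ e ⁆
  IsSimple⇒indep-⁅⁆ {e} (noLoop , _) e∈E =
    decidable-stable (indep? ⁅ e ⁆) λ ¬i →
      noLoop e (x∈p⇒⁅x⁆⊆p e∈E , ¬i , λ (I⊆e , x , x∈e , x∉I) → down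
        (λ y∈I → contradiction
          (subst (_∈ _) (trans (x∈⁅y⁆⇒x≡y e (I⊆e y∈I)) (sym (x∈⁅y⁆⇒x≡y e x∈e))) y∈I) x∉I)
        empty)

module _ {M : Matroid n} where
  open Matroid M

  set⊆E : (F : Flat M) → set F ⊆ E
  set⊆E F x∈ = cl⊆E M (set F) (subst (_ ∈_) (sym (closed F)) x∈)

  cl-least : (F : Flat M) → X ⊆ set F → cl M X ⊆ set F
  cl-least F X⊆F x∈ = subst (_ ∈_) (closed F) (cl-mono M X⊆F x∈)

  r<r-∪⁅⁆ : (F : Flat M) → e ∈ E → e ∉ set F → r M (set F) < r M (set F ∪ ⁅ e ⁆)
  r<r-∪⁅⁆ F e∈E e∉F = ≰⇒> λ le → e∉F (subst (_ ∈_) (closed F) (∈-cl⁺ M e∈E le))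

  r-cl-∪⁅⁆ : (F : Flat M) → e ∈ E → e ∉ set F →
             r M (cl M (set F ∪ ⁅ e ⁆)) ≡ suc (r M (set F))
  r-cl-∪⁅⁆ {e} F e∈E e∉F = trans (r-cl M _) (≤-antisym (r-∪⁅⁆-≤ M (set F) e) (r<r-∪⁅⁆ F e∈E e∉F))

  -- An element of `G` outside `F`, added to `F`, would give a subset of `G` of rank above that of
  -- `G`.
  ⊆∧r≥⇒≡ : {F G : Flat M} → set F ⊆ set G → r M (set G) ≤ r M (set F) → F ≡ G
  ⊆∧r≥⇒≡ {F} {G} F⊆G le = flat-≡ (⊆-antisym F⊆G λ {x} x∈G →
    decidable-stable (x ∈? set F) λ x∉F →
      <⇒≱ (r<r-∪⁅⁆ F (set⊆E G x∈G) x∉F) (≤-trans (r-mono-⊆ M (∪⁅⁆-⊆ F⊆G x∈G)) le))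

  ⊆∧≢⇒r< : {F G : Flat M} → set F ⊆ set G → F ≢ G → r M (set F) < r M (set G)
  ⊆∧≢⇒r< F⊆G F≢G = ≰⇒> (F≢G ∘ ⊆∧r≥⇒≡ F⊆G)

  subflat-of-rank : ∀ {k} (F : Flat M) → r M (set F) ≡ suc k →
                    Σ[ G ∈ Flat M ] set G ⊆ set F × r M (set G) ≡ k
  subflat-of-rank F rF≡ =
    let (Y , Y⊆F , rY≡) = subset-of-rank M rF≡
    in clFlat M Y , cl-least F Y⊆F , trans (r-cl M Y) rY≡

  -- Distinct flats of equal rank are not nested, so the join `S` of `P` and `Q` has larger rank
  -- than `P`. Lying inside `R`, it equals `R`, and every flat above `P` and `Q` contains the join.
  common-cover-⊆ : {P Q R : Flat M} (T : Flat M) → P ≢ Q →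
                   r M (set Q) ≡ r M (set P) → r M (set R) ≡ suc (r M (set P)) →
                   set P ⊆ set R → set Q ⊆ set R →
                   set P ⊆ set T → set Q ⊆ set T → set R ⊆ set T
  common-cover-⊆ {P} {Q} {R} T P≢Q rQ≡ rR≡ P⊆R Q⊆R P⊆T Q⊆T =
    subst (λ G → set G ⊆ set T) S≡R (cl-least T (∪-least P⊆T Q⊆T))
    where
    P∪Q = set P ∪ set Q
    S = clFlat M P∪Q
    P⊆S : set P ⊆ set S
    P⊆S x∈ = ⊆-cl M (p⊆p∪q (set Q) x∈) (set⊆E P x∈)
    Q⊆S : set Q ⊆ set S
    Q⊆S x∈ = ⊆-cl M (q⊆p∪q (set P) (set Q) x∈) (set⊆E Q x∈)
    P≢S : P ≢ S
    P≢S P≡S = P≢Q (sym (⊆∧r≥⇒≡ {F = Q} {G = P}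
      (subst (λ G → set Q ⊆ set G) (sym P≡S) Q⊆S) (≤-reflexive (sym rQ≡))))
    S≡R : S ≡ R
    S≡R = ⊆∧r≥⇒≡ {F = S} {G = R} (cl-least R (∪-least P⊆R Q⊆R))
      (≤-trans (≤-reflexive rR≡) (⊆∧≢⇒r< {F = P} {G = S} P⊆S P≢S))

  -- Enlarge `F` by one rank at a time, keeping `e` outside: while the corank exceeds one, add an
  -- element `y` that raises the rank of `set F ∪ ⁅ e ⁆`. The fuel `k` bounds the number of
  -- enlargements.
  separating-hyperplane : (F : Flat M) → e ∈ E → e ∉ set F →
                          Σ[ H ∈ Flat M ] IsHyperplane H × set F ⊆ set H × e ∉ set H
  separating-hyperplane {e} F e∈E e∉F = go (rank M) F e∉F (m≤m+n _ _)
    where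
    go : ∀ k (F : Flat M) → e ∉ set F → rank M ≤ k + suc (r M (set F)) →
         Σ[ H ∈ Flat M ] IsHyperplane H × set F ⊆ set H × e ∉ set H
    go k F e∉F le with rank M ≤? suc (r M (set F))
    ... | yes le′ = F , ≤-antisym
                          (≤-trans (r<r-∪⁅⁆ F e∈E e∉F) (r-mono-⊆ M (∪⁅⁆-⊆ (set⊆E F) e∈E))) le′ ,
                    ⊆-refl , e∉F
    go zero    F e∉F le | no ¬le = contradiction le ¬le
    go (suc k) F e∉F le | no ¬le =
      let (H , h , G⊆H , e∉H) = go k G e∉G rank≤ in H , h , G⊆H ∘ F⊆G , e∉H
      where
      aug = r-augment M {X = set F ∪ ⁅ e ⁆} (≤-trans (s≤s (r-∪⁅⁆-≤ M (set F) e)) (≰⇒> ¬le))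
      y = proj₁ aug
      y∈E = proj₁ (proj₂ aug)
      r< = proj₂ (proj₂ (proj₂ aug))
      G = clFlat M (set F ∪ ⁅ y ⁆)
      F⊆G : set F ⊆ set G
      F⊆G x∈ = ⊆-cl M (p⊆p∪q ⁅ y ⁆ x∈) (set⊆E F x∈)
      y∈G : y ∈ set G
      y∈G = ⊆-cl M (e∈X∪⁅e⁆ (set F) y) y∈E
      y∉F : y ∉ set F
      y∉F y∈F = <⇒≱ r< (r-mono-⊆ M (∪⁅⁆-⊆ ⊆-refl (p⊆p∪q ⁅ e ⁆ y∈F)))
      rG≡ : r M (set G) ≡ suc (r M (set F))
      rG≡ = r-cl-∪⁅⁆ F y∈E y∉F
      -- Otherwise `G` would contain `F`, `e` and `y`, yet its rank is already attained by
      -- `set F ∪ ⁅ e ⁆`.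
      e∉G : e ∉ set G
      e∉G e∈G = <⇒≱ r< (≤-trans (r-mono-⊆ M (∪⁅⁆-⊆ (∪⁅⁆-⊆ F⊆G e∈G) y∈G))
                        (≤-trans (≤-reflexive rG≡) (r<r-∪⁅⁆ F e∈E e∉F)))
      rank≤ : rank M ≤ k + suc (r M (set G))
      rank≤ = ≤-trans le (≤-reflexive (trans (sym (+-suc k _)) (cong (λ i → k + suc i) (sym rG≡))))

  -- Distinct `e` and `f` would be parallel: the pair is too large to be independent in rank 1, and
  -- a proper subset of it lies in one of the two singletons, which simplicity makes independent.
  point-elements-≡ : IsSimple M → (P : Flat M) → IsPoint P →
                     ∀ {e f} → e ∈ set P → f ∈ set P → e ≡ f
  point-elements-≡ simple P rP≡1 {e} {f} e∈P f∈P = decidable-stable (e ≟ f) λ e≢f →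
    proj₂ simple e f (e≢f , (λ x∈ → set⊆E P (ef⊆P x∈)) , dependent e≢f , minimal)
    where
    ef⊆P : ⁅ e ⁆ ∪ ⁅ f ⁆ ⊆ set P
    ef⊆P = ∪⁅⁆-⊆ (x∈p⇒⁅x⁆⊆p e∈P) f∈P
    dependent : e ≢ f → ¬ Indep (⁅ e ⁆ ∪ ⁅ f ⁆)
    dependent e≢f i = <⇒≱ (∣p∣<∣p∪⁅x⁆∣ {X = ⁅ e ⁆} (e≢f ∘ sym ∘ x∈⁅y⁆⇒x≡y e))
      (≤-trans (indep⇒≤r M i ef⊆P) (≤-reflexive (trans rP≡1 (sym (∣⁅x⁆∣≡1 e)))))
    omit : ∀ {I} g {x} → x ∈ ⁅ g ⁆ → x ∉ I → ∀ {y} → y ∈ ⁅ g ⁆ → y ∉ I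
    omit {I} g x∈g x∉I y∈g y∈I =
      x∉I (subst (_∈ I) (trans (x∈⁅y⁆⇒x≡y g y∈g) (sym (x∈⁅y⁆⇒x≡y g x∈g))) y∈I)
    minimal : ∀ {I} → I ⊂ ⁅ e ⁆ ∪ ⁅ f ⁆ → Indep I
    minimal {I} (I⊆ , x , x∈ef , x∉I) =
      [ (λ x∈e → down {J = ⁅ f ⁆}
          (λ y∈I → [ (λ y∈e → contradiction y∈I (omit e x∈e x∉I y∈e)) , id ]′
                   (x∈p∪q⁻ ⁅ e ⁆ ⁅ f ⁆ (I⊆ y∈I)))
          (IsSimple⇒indep-⁅⁆ M simple (set⊆E P f∈P)))
      , (λ x∈f → down {J = ⁅ e ⁆}
          (λ y∈I → [ id , (λ y∈f → contradiction y∈I (omit f x∈f x∉I y∈f)) ]′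
                   (x∈p∪q⁻ ⁅ e ⁆ ⁅ f ⁆ (I⊆ y∈I)))
          (IsSimple⇒indep-⁅⁆ M simple (set⊆E P e∈P)))
      ]′ (x∈p∪q⁻ ⁅ e ⁆ ⁅ f ⁆ x∈ef)

  point≡⁅⁆ : IsSimple M → (P : Flat M) → IsPoint P → ∃[ e ] set P ≡ ⁅ e ⁆
  point≡⁅⁆ simple P rP≡1 =
    let (e , e∈P , _) = r-augment M {X = ⊥} {Y = set P}
          (≤-trans (s≤s (≤-reflexive (r⊥≡0 M))) (≤-reflexive (sym rP≡1)))
    in e , ⊆-antisym
      (λ f∈P → subst (_∈ ⁅ e ⁆) (point-elements-≡ simple P rP≡1 e∈P f∈P) (x∈⁅x⁆ e))
      (x∈p⇒⁅x⁆⊆p e∈P)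

-- Deletion

module _ (M : Matroid n) (D : Subset n) where
  open Matroid M

  r-∖ : X ⊆ E ─ D → r (M ∖ D) X ≡ r M X
  r-∖ {X} X⊆ =
    let ((i , _) , I⊆X) = maxIndep-spec (M ∖ D) X
        (j , J⊆X)       = maxIndep-spec M X
    in ≤-antisym (indep⇒≤r M i I⊆X)
                 (indep⇒≤r (M ∖ D) (j , λ x∈ → X⊆ (J⊆X x∈)) J⊆X)

  cl-∖ : X ⊆ E ─ D → cl (M ∖ D) X ≡ cl M X ─ D
  cl-∖ {X} X⊆ = ⊆-antisym to from
    where
    r-∪≡ : e ∈ E ─ D → r (M ∖ D) (X ∪ ⁅ e ⁆) ≡ r M (X ∪ ⁅ e ⁆)
    r-∪≡ e∈ = r-∖ (∪⁅⁆-⊆ X⊆ e∈)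
    to : cl (M ∖ D) X ⊆ cl M X ─ D
    to x∈ = let (x∈E─D , r≡) = ∈-comprehension⁻ (inClosure? (M ∖ D) X) x∈ in
      x∈p∧x∉q⇒x∈p─q
        (∈-cl⁺ M (p─q⊆p E D x∈E─D) (≤-reflexive (trans (sym (r-∪≡ x∈E─D)) (trans r≡ (r-∖ X⊆)))))
        (x∈p─q⇒x∉q E D x∈E─D)
    from : cl M X ─ D ⊆ cl (M ∖ D) X
    from x∈ =
      let (x∈E , r≡) = ∈-comprehension⁻ (inClosure? M X) (p─q⊆p (cl M X) D x∈)
          x∈E─D = x∈p∧x∉q⇒x∈p─q x∈E (x∈p─q⇒x∉q (cl M X) D x∈)
      in ∈-cl⁺ (M ∖ D) x∈E─D (≤-reflexive (trans (r-∪≡ x∈E─D) (trans r≡ (sym (r-∖ X⊆)))))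

  flat-∖ : Flat M → Flat (M ∖ D)
  flat-∖ F = flat (set F ─ D) (⊆-antisym to from)
    where
    F─D⊆ : set F ─ D ⊆ E ─ D
    F─D⊆ = ─-monoˡ-⊆ D (set⊆E F)
    to : cl (M ∖ D) (set F ─ D) ⊆ set F ─ D
    to x∈ = ─-monoˡ-⊆ D (cl-least F (p─q⊆p (set F) D)) (subst (_ ∈_) (cl-∖ F─D⊆) x∈)
    from : set F ─ D ⊆ cl (M ∖ D) (set F ─ D)
    from x∈ = ⊆-cl (M ∖ D) x∈ (F─D⊆ x∈)

  -- The basis `B` supplied by coindependence avoids `D`, and maximality gives it size `rank M`.
  rank-∖ : Coindependent M D → rank (M ∖ D) ≡ rank M
  rank-∖ (B , (iB , maximal) , D⊆) =
    trans (r-∖ ⊆-refl) (≤-antisym (r-mono-⊆ M (p─q⊆p E D))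
                                  (≤-trans rank≤∣B∣ (indep⇒≤r M iB B⊆E─D)))
    where
    B⊆E─D : B ⊆ E ─ D
    B⊆E─D x∈B = x∈p∧x∉q⇒x∈p─q (indep⊆E iB x∈B) λ x∈D → x∈p─q⇒x∉q E B (D⊆ x∈D) x∈B
    rank≤∣B∣ : rank M ≤ ∣ B ∣
    rank≤∣B∣ = ≮⇒≥ λ lt →
      let (e , _ , e∉B , i) = augment iB (proj₁ (maxIndep-spec M E)) lt
      in e∉B (subst (e ∈_) (maximal i (p⊆p∪q ⁅ e ⁆)) (e∈X∪⁅e⁆ B e))

  circuit-∖ : IsCircuit (M ∖ D) X → IsCircuit M X
  circuit-∖ (C⊆ , dependent , minimal) =
    (λ x∈ → p─q⊆p E D (C⊆ x∈)) , (λ i → dependent (i , C⊆)) , (λ I⊂C → proj₁ (minimal I⊂C))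

  simple-∖ : IsSimple M → IsSimple (M ∖ D)
  simple-∖ (noLoop , noParallel) =
    (λ e loop → noLoop e (circuit-∖ loop)) ,
    (λ e f (e≢f , circuit) → noParallel e f (e≢f , circuit-∖ circuit))

-- Injective antitone maps between lattices of flats

module _ {M : Matroid m} {N : Matroid n} (ψ : Flat M → Flat N)
         (injective : Injective _≡_ _≡_ ψ)
         (antitone : ∀ {F G} → set F ⊆ set G → set (ψ G) ⊆ set (ψ F)) where
  open Matroid M

  -- Nested images of equal rank would coincide, and injectivity would then equate the ranks of `F`
  -- and `G`.
  r-antitone : ∀ {F G} → set F ⊆ set G → r M (set F) < r M (set G) →
               r N (set (ψ G)) < r N (set (ψ F))
  r-antitone {F} {G} F⊆G lt = ⊆∧≢⇒r< {F = ψ G} {G = ψ F} (antitone F⊆G) λ ψG≡ψF →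
    <⇒≢ lt (cong (r M ∘ set) (sym (injective ψG≡ψF)))

  -- Climb from `F` to full rank, one rank at a time; every step costs the image at least one unit
  -- of rank.
  rank≤r+r : ∀ F → rank M ≤ r M (set F) + r N (set (ψ F))
  rank≤r+r F = go (rank M) F (m≤m+n _ _)
    where
    go : ∀ k F → rank M ≤ k + r M (set F) → rank M ≤ r M (set F) + r N (set (ψ F))
    go zero    F le = ≤-trans le (m≤m+n _ _)
    go (suc k) F le with rank M ≤? r M (set F)
    ... | yes le′ = ≤-trans le′ (m≤m+n _ _)
    ... | no ¬le = begin
      rank M                              ≤⟨ go k G (≤-trans le (≤-reflexive
                                               (trans (sym (+-suc k _)) (cong (k +_) (sym rG≡))))) ⟩
      r M (set G) + r N (set (ψ G))       ≡⟨ cong (_+ r N (set (ψ G))) rG≡ ⟩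
      suc (r M (set F)) + r N (set (ψ G)) ≡⟨ sym (+-suc _ _) ⟩
      r M (set F) + suc (r N (set (ψ G))) ≤⟨ +-monoʳ-≤ (r M (set F))
                                               (r-antitone {F} {G} F⊆G (≤-reflexive (sym rG≡))) ⟩
      r M (set F) + r N (set (ψ F))       ∎
      where
      open ≤-Reasoning
      aug = r-augment M {X = set F} (≰⇒> ¬le)
      y = proj₁ aug
      y∉F : y ∉ set F
      y∉F y∈F = <⇒≱ (proj₂ (proj₂ (proj₂ aug))) (r-mono-⊆ M (∪⁅⁆-⊆ ⊆-refl y∈F))
      G = clFlat M (set F ∪ ⁅ y ⁆)
      rG≡ : r M (set G) ≡ suc (r M (set F))
      rG≡ = r-cl-∪⁅⁆ F (proj₁ (proj₂ aug)) y∉F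
      F⊆G : set F ⊆ set G
      F⊆G x∈ = ⊆-cl M (p⊆p∪q ⁅ y ⁆ x∈) (set⊆E F x∈)

  -- Descend from `F` to rank 0; every step raises the rank of the image, which never exceeds
  -- `rank N`.
  r+r≤rank : ∀ F → r M (set F) + r N (set (ψ F)) ≤ rank N
  r+r≤rank F = go (r M (set F)) F refl
    where
    go : ∀ k F → r M (set F) ≡ k → k + r N (set (ψ F)) ≤ rank N
    go zero    F rF≡ = r-mono-⊆ N (set⊆E (ψ F))
    go (suc k) F rF≡ =
      let (G , G⊆F , rG≡) = subflat-of-rank F rF≡ in
      ≤-trans (≤-reflexive (sym (+-suc k _)))
        (≤-trans (+-monoʳ-≤ k (r-antitone {G} {F} G⊆F (≤-reflexive (trans (cong suc rG≡) (sym rF≡)))))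
                 (go k G rG≡))

  -- Both bounds are evaluated at the flat of loops. For `φ∖D` this yields the lower bound on the
  -- rank of the deleted adjoint.
  rank≤rank : rank M ≤ rank N
  rank≤rank = ≤-trans (rank≤r+r ∅) (r+r≤rank ∅)
    where ∅ = clFlat M ⊥

  module _ (same-rank : rank N ≡ rank M) where

    r+r≡rank : ∀ F → r M (set F) + r N (set (ψ F)) ≡ rank M
    r+r≡rank F = ≤-antisym (≤-trans (r+r≤rank F) (≤-reflexive same-rank)) (rank≤r+r F)

    -- The flat `G₁` is a second cover of `G′`, different from `G` because it contains `p`. As it
    -- also lies above `P`, antitonicity puts its image inside `ψ P`, and `common-cover-⊆` applies.
    ψG⊆ψcl⁅⁆-descends : ∀ {p} → p ∈ E → ∀ G G′ → p ∉ set G → set G′ ⊆ set G →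
                        r M (set G) ≡ suc (r M (set G′)) →
                        set (ψ G) ⊆ set (ψ (clFlat M ⁅ p ⁆)) → set (ψ G′) ⊆ set (ψ (clFlat M ⁅ p ⁆))
    ψG⊆ψcl⁅⁆-descends {p} p∈E G G′ p∉G G′⊆G rG≡ ψG⊆ =
      common-cover-⊆ {P = ψ G} {Q = ψ G₁} {R = ψ G′} (ψ P) ψG≢ψG₁ rψG₁≡ rψG′≡
        (antitone {G′} {G} G′⊆G) (antitone {G′} {G₁} G′⊆G₁) ψG⊆ (antitone {P} {G₁} P⊆G₁)
      where
      P = clFlat M ⁅ p ⁆
      p∉G′ : p ∉ set G′
      p∉G′ = p∉G ∘ G′⊆G
      G₁ = clFlat M (set G′ ∪ ⁅ p ⁆)
      p∈G₁ : p ∈ set G₁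
      p∈G₁ = ⊆-cl M (e∈X∪⁅e⁆ (set G′) p) p∈E
      G′⊆G₁ : set G′ ⊆ set G₁
      G′⊆G₁ x∈ = ⊆-cl M (p⊆p∪q ⁅ p ⁆ x∈) (set⊆E G′ x∈)
      P⊆G₁ : set P ⊆ set G₁
      P⊆G₁ = cl-least G₁ (x∈p⇒⁅x⁆⊆p p∈G₁)
      ψG≢ψG₁ : ψ G ≢ ψ G₁
      ψG≢ψG₁ eq = p∉G (subst (λ F → p ∈ set F) (sym (injective eq)) p∈G₁)
      rG₁≡ : r M (set G₁) ≡ r M (set G)
      rG₁≡ = trans (r-cl-∪⁅⁆ G′ p∈E p∉G′) (sym rG≡)
      rψG₁≡ : r N (set (ψ G₁)) ≡ r N (set (ψ G))
      rψG₁≡ = +-cancelˡ-≡ (r M (set G)) _ _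
        (trans (cong (_+ r N (set (ψ G₁))) (sym rG₁≡)) (trans (r+r≡rank G₁) (sym (r+r≡rank G))))
      rψG′≡ : r N (set (ψ G′)) ≡ suc (r N (set (ψ G)))
      rψG′≡ = +-cancelˡ-≡ (r M (set G′)) _ _ (begin
        r M (set G′) + r N (set (ψ G′))       ≡⟨ r+r≡rank G′ ⟩
        rank M                                ≡⟨ sym (r+r≡rank G) ⟩
        r M (set G) + r N (set (ψ G))         ≡⟨ cong (_+ r N (set (ψ G))) rG≡ ⟩
        suc (r M (set G′)) + r N (set (ψ G))  ≡⟨ sym (+-suc _ _) ⟩
        r M (set G′) + suc (r N (set (ψ G)))  ∎)
        where open ≡-Reasoning

    ψ⊆ψcl⁅⁆⇒∈ : ∀ {p} → p ∈ E → ∀ G → set (ψ G) ⊆ set (ψ (clFlat M ⁅ p ⁆)) → p ∈ set G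
    ψ⊆ψcl⁅⁆⇒∈ {p} p∈E G ψG⊆ = decidable-stable (p ∈? set G) λ p∉G → go _ G refl p∉G ψG⊆
      where
      P = clFlat M ⁅ p ⁆
      go : ∀ k G → r M (set G) ≡ k → p ∉ set G → ¬ (set (ψ G) ⊆ set (ψ P))
      -- In rank 0 the rank formula turns `ψ G ⊆ ψ P` into `P` having rank 0, so `p` is a loop and
      -- lies in every flat.
      go zero G rG≡ p∉G ψG⊆ = p∉G (cl-least G ⊥⊆
        (∈-cl⁺ M p∈E (≤-trans (r-mono-⊆ M (∪-least ⊥⊆ ⊆-refl))
          (≤-trans (≤-reflexive (sym (r-cl M ⁅ p ⁆)))
            (≤-trans rP≤rG (≤-trans (≤-reflexive rG≡) z≤n))))))
        where
        rP≤rG : r M (set P) ≤ r M (set G)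
        rP≤rG = +-cancelʳ-≤ (r N (set (ψ G))) _ _
          (≤-trans (+-monoʳ-≤ (r M (set P)) (r-mono-⊆ N ψG⊆))
                   (≤-reflexive (trans (r+r≡rank P) (sym (r+r≡rank G)))))
      go (suc k) G rG≡ p∉G ψG⊆ =
        let (G′ , G′⊆G , rG′≡) = subflat-of-rank G rG≡
        in go k G′ rG′≡ (p∉G ∘ G′⊆G)
             (ψG⊆ψcl⁅⁆-descends p∈E G G′ p∉G G′⊆G (trans rG≡ (cong suc (sym rG′≡))) ψG⊆)

    -- For each `x ∈ F` the closure of `⁅ x ⁆` lies in `F`, so antitonicity puts `ψ F` inside the
    -- image of that closure.
    ψ-reflects-⊆ : ∀ {F G} → set (ψ G) ⊆ set (ψ F) → set F ⊆ set G
    ψ-reflects-⊆ {F} {G} ψG⊆ψF x∈F = ψ⊆ψcl⁅⁆⇒∈ (set⊆E F x∈F) G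
      (λ y∈ → antitone (cl-least F (x∈p⇒⁅x⁆⊆p x∈F)) (ψG⊆ψF y∈))

-- The adjoint map of a deletion

module DeletionAdjoint {M : Matroid m} {M′ : Matroid n} {φ : Flat M → Flat M′}
                       (adjoint : IsAdjointMap M M′ φ)
                       (D : Subset m) (coindependent : Coindependent M D) where
  open IsAdjointMap adjoint

  K : Subset n
  K = elementImage φ (𝓗? M D)

  N : Matroid n
  N = M′ ∖ K

  -- Repeats the decision procedure inside `elementImage`, so that the comprehension lemmas apply to
  -- `K`.
  ∈K? : ∀ e → Dec (Σ[ H ∈ Flat M ] 𝓗 M D H × set (φ H) ≡ ⁅ e ⁆)
  ∈K? e = anyFlat? (λ H → 𝓗? M D H ×-dec (set (φ H) ≟ˢ ⁅ e ⁆))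

  clM : Flat (M ∖ D) → Flat M
  clM F = clFlat M (set F)

  clM─D : ∀ F → set (clM F) ─ D ≡ set F
  clM─D F = trans (sym (cl-∖ M D (set⊆E F))) (closed F)

  r-clM : ∀ F → r M (set (clM F)) ≡ r (M ∖ D) (set F)
  r-clM F = trans (r-cl M (set F)) (sym (r-∖ M D (set⊆E F)))

  clM-hyperplane : ∀ {F} → IsHyperplane F → IsHyperplane (clM F)
  clM-hyperplane {F} h = trans (cong suc (r-clM F)) (trans h (rank-∖ M D coindependent))

  φ∖D : Flat (M ∖ D) → Flat N
  φ∖D F = flat-∖ M′ K (φ (clM F))

  -- This keeps `clM F` out of `𝓗 M D`: it is spanned by `set F`, which avoids `D`.
  clM-spanned : ∀ F → r M (set (clM F)) ≤ r M (set (clM F) ─ D)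
  clM-spanned F = ≤-reflexive (trans (r-cl M (set F)) (cong (r M) (sym (clM─D F))))

  -- A member of `𝓗 M D` with the same image would equal `clM F` by injectivity, contradicting
  -- `clM-spanned`.
  φclM-element : ∀ {F} → IsHyperplane F → ∃[ e ] set (φ (clM F)) ≡ ⁅ e ⁆ × e ∉ K
  φclM-element {F} h =
    let (e , φF≡) = point≡⁅⁆ simple (φ (clM F)) (toPoint {clM F} (clM-hyperplane {F} h))
    in e , φF≡ , λ e∈K →
      let (H , (_ , lt) , φH≡) = ∈-comprehension⁻ ∈K? e∈K
          H≡clF = injective {H} {clM F} (flat-≡ (trans φH≡ (sym φF≡)))
      in <⇒≱ (subst (λ G → r M (set G ─ D) < r M (set G)) H≡clF lt) (clM-spanned F)

  φ∖D-hyperplane : ∀ {F} → IsHyperplane F → set (φ∖D F) ≡ set (φ (clM F))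
  φ∖D-hyperplane {F} h = let (e , φF≡ , e∉K) = φclM-element {F} h in
    trans (cong (_─ K) φF≡) (trans (x∉p⇒⁅x⁆─p≡⁅x⁆ e∉K) (sym φF≡))

  φ∖D-antitone : ∀ {F G} → set F ⊆ set G → set (φ∖D G) ⊆ set (φ∖D F)
  φ∖D-antitone {F} {G} F⊆G = ─-monoˡ-⊆ K (antitone {clM F} {clM G} (cl-mono M F⊆G))

  -- Deleting `K` may shrink the image of a flat, but not that of a hyperplane. For a hyperplane `H`
  -- of `M ∖ D` that contains `F` and misses `x`, the whole of `φ (clM H)` therefore lies in
  -- `φ (clM G)`. Reflection for `φ` and removal of `D` then put `x` in `H`.
  φ∖D-reflects-⊆ : ∀ {F G} → set (φ∖D F) ⊆ set (φ∖D G) → set G ⊆ set F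
  φ∖D-reflects-⊆ {F} {G} φF⊆φG {x} x∈G = decidable-stable (x ∈? set F) λ x∉F →
    let (H , h , F⊆H , x∉H) = separating-hyperplane F (set⊆E G x∈G) x∉F
        φH⊆φG : set (φ (clM H)) ⊆ set (φ (clM G))
        φH⊆φG = λ y∈ → p─q⊆p _ K (φF⊆φG (φ∖D-antitone {F} {H} F⊆H
                         (subst (_ ∈_) (sym (φ∖D-hyperplane {H} h)) y∈)))
        clG⊆clH : set (clM G) ⊆ set (clM H)
        clG⊆clH = ψ-reflects-⊆ φ injective antitone same-rank {clM G} {clM H} φH⊆φG
    in x∉H (subst (x ∈_) (clM─D H)
         (─-monoˡ-⊆ D clG⊆clH (subst (x ∈_) (sym (clM─D G)) x∈G)))

  φ∖D-injective : Injective _≡_ _≡_ φ∖D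
  φ∖D-injective {F} {G} eq = flat-≡ (⊆-antisym
    (φ∖D-reflects-⊆ {G} {F} (⊆-reflexive (cong set (sym eq))))
    (φ∖D-reflects-⊆ {F} {G} (⊆-reflexive (cong set eq))))

  φ∖D-toPoint : ∀ {F} → IsHyperplane F → IsPoint (φ∖D F)
  φ∖D-toPoint {F} h = trans (r-∖ M′ K (set⊆E (φ∖D F)))
    (trans (cong (r M′) (φ∖D-hyperplane {F} h)) (toPoint {clM F} (clM-hyperplane {F} h)))

  N-simple : IsSimple N
  N-simple = simple-∖ M′ K simple

  -- Deletion cannot raise the rank, and the injective antitone map `φ∖D` prevents it from dropping.
  rank-N : rank N ≡ rank (M ∖ D)
  rank-N = ≤-antisym
    (begin
      rank N                     ≡⟨ r-∖ M′ K ⊆-refl ⟩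
      r M′ (Matroid.E M′ ─ K)    ≤⟨ r-mono-⊆ M′ (p─q⊆p (Matroid.E M′) K) ⟩
      rank M′                    ≡⟨ same-rank ⟩
      rank M                     ≡⟨ sym (rank-∖ M D coindependent) ⟩
      rank (M ∖ D)               ∎)
    (rank≤rank φ∖D (λ {F} {G} → φ∖D-injective {F} {G}) (λ {F} {G} → φ∖D-antitone {F} {G}))
    where open ≤-Reasoning

  -- By simplicity the closure of `⁅ e ⁆` is the point `⁅ e ⁆` itself, and `φ` is onto the points.
  hyperplane-over : e ∈ Matroid.E M′ → Σ[ H ∈ Flat M ] IsHyperplane H × set (φ H) ≡ ⁅ e ⁆
  hyperplane-over {e} e∈E =
    let ((H , h) , φH≡) = proj₂ bijective (Q , Q-point)
    in H , h , trans (cong (set ∘ proj₁) (φH≡ refl)) Q≡⁅e⁆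
    where
    Q = clFlat M′ ⁅ e ⁆
    e∈Q : e ∈ set Q
    e∈Q = ⊆-cl M′ (x∈⁅x⁆ e) e∈E
    Q-point : IsPoint Q
    Q-point = trans (r-cl M′ ⁅ e ⁆)
      (trans (r-indep M′ (IsSimple⇒indep-⁅⁆ M′ simple e∈E)) (∣⁅x⁆∣≡1 e))
    Q≡⁅e⁆ : set Q ≡ ⁅ e ⁆
    Q≡⁅e⁆ = ⊆-antisym
      (λ f∈Q → subst (_∈ ⁅ e ⁆) (point-elements-≡ simple Q Q-point e∈Q f∈Q) (x∈⁅x⁆ e))
      (x∈p⇒⁅x⁆⊆p e∈Q)

  -- As `e ∉ K`, removing `D` does not lower the rank of `H`; hence `set H ─ D` spans `H` and is a
  -- hyperplane of `M ∖ D`.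
  φ∖D-hyperplane-over : e ∉ K → (H : Flat M) → IsHyperplane H → set (φ H) ≡ ⁅ e ⁆ →
                        Σ[ F ∈ Flat (M ∖ D) ] IsHyperplane F × set (φ∖D F) ≡ ⁅ e ⁆
  φ∖D-hyperplane-over {e} e∉K H h φH≡⁅e⁆ = F , F-hyperplane ,
    trans (cong (λ G → set (φ G) ─ K) clF≡H) (trans (cong (_─ K) φH≡⁅e⁆) (x∉p⇒⁅x⁆─p≡⁅x⁆ e∉K))
    where
    rH≤ : r M (set H) ≤ r M (set H ─ D)
    rH≤ = ≮⇒≥ λ lt → e∉K (∈-comprehension⁺ ∈K? (H , (h , lt) , φH≡⁅e⁆))
    F = flat-∖ M D H
    clF≡H : clM F ≡ H
    clF≡H = ⊆∧r≥⇒≡ {F = clM F} {G = H} (cl-least H (p─q⊆p (set H) D))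
      (≤-trans rH≤ (≤-reflexive (sym (r-cl M (set H ─ D)))))
    F-hyperplane : IsHyperplane F
    F-hyperplane = trans (cong suc (trans (sym (r-clM F)) (cong (r M ∘ set) clF≡H)))
      (trans h (sym (rank-∖ M D coindependent)))

  φ∖D-onto-points : (P : Flat N) → IsPoint P → Σ[ F ∈ Flat (M ∖ D) ] IsHyperplane F × φ∖D F ≡ P
  φ∖D-onto-points P rP≡1 =
    let (e , P≡⁅e⁆) = point≡⁅⁆ N-simple P rP≡1
        e∈N = set⊆E P (subst (e ∈_) (sym P≡⁅e⁆) (x∈⁅x⁆ e))
        (H , h , φH≡) = hyperplane-over (p─q⊆p (Matroid.E M′) K e∈N)
        (F , hF , φF≡) = φ∖D-hyperplane-over (x∈p─q⇒x∉q (Matroid.E M′) K e∈N) H h φH≡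
    in F , hF , flat-≡ (trans φF≡ (sym P≡⁅e⁆))

  φ∖D-adjoint : IsAdjointMap (M ∖ D) N φ∖D
  φ∖D-adjoint = record
    { simple    = N-simple
    ; same-rank = rank-N
    ; injective = φ∖D-injective
    ; antitone  = λ {F} {G} → φ∖D-antitone {F} {G}
    ; toPoint   = λ {F} → φ∖D-toPoint {F}
    ; bijective = (λ eq → pair-≡ (φ∖D-injective (cong proj₁ eq)))
                , (λ (P , p) → let (F , h , φF≡P) = φ∖D-onto-points P p in
                     (F , h) , λ { refl → pair-≡ φF≡P })
    }
    where
    -- Being a hyperplane or a point is an equation in `ℕ`, hence proof-irrelevant, so only the
    -- flats need comparing.
    pair-≡ : ∀ {A : Set} {f g : A → ℕ} {x y : ∃ λ a → f a ≡ g a} → proj₁ x ≡ proj₁ y → x ≡ y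
    pair-≡ {x = a , p} {.a , q} refl = cong (a ,_) (≡-irrelevant p q)

lemma3p3 : ∀ {m n : ℕ} (M : Matroid m) (M′ : Matroid n) (φ : Flat M → Flat M′) →
    IsAdjointMap M M′ φ →
    (D : Subset m) → Coindependent M D →
    let X = elementImage φ (𝓗? M D)
        N = M′ ∖ X
    in Σ[ φ∖D ∈ (Flat (M ∖ D) → Flat N) ]
         IsAdjointMap (M ∖ D) N φ∖D ×
         ((F : Flat (M ∖ D)) → set (φ∖D F) ≡ set (φ (clFlat M (set F))) ─ X)
-- The formula holds by `refl` because `flat-∖` removes `K` from the underlying set.
lemma3p3 M M′ φ adjoint D coindependent = φ∖D , φ∖D-adjoint , λ _ → refl
  where open DeletionAdjoint adjoint D coindependent
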